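{- For an integer $h\ge 1$, let $T_h$ be the complete binary tree of height $h$. Then $$\gamma(T_h)=\left\lfloor\frac{2^{h+2}+3}{7}\right\rfloor,\qquad \zeta(T_h)=\begin{cases}3,& h\equiv 0\pmod 3\ \text{and } h\ge 3,\\ 1,&\text{otherwise}.\end{cases}$$
   Context: The complete binary tree $T_h$ of height $h$ is the rooted tree in which every vertex at distance less than $h$ from the root has exactly two children and the vertices at distance $h$ from the root are leaves; thus $|V(T_h)|=2^{h+1}-1$. It is regarded as a finite simple (undirected) graph. For a finite simple graph $G$, a set $D\subseteq V(G)$ is dominating if every vertex of $G$ lies in $D$ or has a neighbor in $D$. The domination number $\gamma(G)$ is the minimum size of a dominating set. The dominion $\zeta(G)$ is the number of dominating sets of $G$ of size $\gamma(G)$. -}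

module Defs where

open import Data.Bool.Base using (true; false)
open import Data.Empty using (⊥-elim)
open import Data.Fin.Base using (Fin; zero; suc; _↑ˡ_; _↑ʳ_; splitAt; join)
open import Data.Fin.Properties using (splitAt-↑ˡ; splitAt-↑ʳ; join-splitAt; all?; any?)
open import Data.Fin.Subset using (Subset; ∣_∣; inside; outside) renaming (_∈_ to _∈ˢ_; ⊤ to full)
open import Data.Fin.Subset.Properties using (∈⊤; ∣⊤∣≡n) renaming (_∈?_ to _∈ˢ?_)
open import Data.List.Base using (List; []; _∷_; _++_; map; filter; length)
open import Data.List.Extrema.Nat using (min; argmin-sel; min≤xs)
open import Data.List.Membership.Propositional using (_∈_)
open import Data.List.Membership.Propositional.Properties
  using (∈-map⁺; ∈-map⁻; ∈-++⁺ˡ; ∈-++⁺ʳ; ∈-filter⁺; ∈-filter⁻)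
open import Data.List.Relation.Unary.All using ([]; lookup)
open import Data.List.Relation.Unary.AllPairs using ([]; _∷_)
open import Data.List.Relation.Unary.Any using (here)
open import Data.List.Relation.Unary.Unique.Propositional using (Unique)
open import Data.List.Relation.Unary.Unique.Propositional.Properties using (map⁺; ++⁺; filter⁺)
open import Data.Nat.Base using (ℕ; zero; suc; _+_; _∸_; _^_; _≤_; _<_; z≤n; s≤s)
open import Data.Nat.Properties using (_≟_; +-suc; +-identityʳ; suc-injective)
open import Data.Product.Base using (∃; ∃₂; _×_; _,_; proj₁; proj₂)
open import Data.Sum.Base using (_⊎_; inj₁; inj₂; [_,_]′)
open import Data.Vec.Base using ([]; _∷_)
open import Data.Vec.Properties using (∷-injectiveʳ)
open import Function.Base using (id; _∘_)
open import Function.Bundles using (_↔_; _⇔_; Inverse; Equivalence; mk↔ₛ′; mk⇔)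
open import Level using (0ℓ)
open import Relation.Binary.Construct.Closure.Symmetric using (SymClosure; fwd; bwd; symmetric)
open import Relation.Binary.Core using (Rel)
open import Relation.Binary.Definitions using (Symmetric; Irreflexive; Decidable)
open import Relation.Binary.PropositionalEquality
  using (_≡_; _≢_; refl; sym; trans; cong; cong₂; subst; module ≡-Reasoning)
open import Relation.Nullary using (¬_; Dec; yes; no)
open import Relation.Nullary.Decidable using (map′; _⊎-dec_; _×-dec_)
open import Relation.Unary using () renaming (Decidable to Decidable₁)

subsets : ∀ n → List (Subset n)
subsets zero    = [] ∷ []
subsets (suc n) = map (outside ∷_) (subsets n) ++ map (inside ∷_) (subsets n)

∈-subsets : ∀ {n} (D : Subset n) → D ∈ subsets n
∈-subsets []          = here refl
∈-subsets (false ∷ D) = ∈-++⁺ˡ (∈-map⁺ (outside ∷_) (∈-subsets D))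
∈-subsets (true  ∷ D) = ∈-++⁺ʳ (map (outside ∷_) (subsets _)) (∈-map⁺ (inside ∷_) (∈-subsets D))

subsets-unique : ∀ n → Unique (subsets n)
subsets-unique zero    = [] ∷ []
subsets-unique (suc n) =
  ++⁺ (map⁺ ∷-injectiveʳ (subsets-unique n)) (map⁺ ∷-injectiveʳ (subsets-unique n)) disjoint
  where
  disjoint : ∀ {D} → ¬ (D ∈ map (outside ∷_) (subsets n) × D ∈ map (inside ∷_) (subsets n))
  disjoint (p , q) with ∈-map⁻ (outside ∷_) p | ∈-map⁻ (inside ∷_) q
  ... | _ , _ , refl | _ , _ , ()

-- The bijection `index` only serves to encode vertex sets as `Subset order`.

record FiniteSimpleGraph : Set₁ where
  infix 4 _~_ _~?_
  field
    Vertex   : Set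
    order    : ℕ
    index    : Vertex ↔ Fin order
    _~_      : Rel Vertex 0ℓ
    ~-sym    : Symmetric _~_
    ~-irrefl : Irreflexive _≡_ _~_
    _~?_     : Decidable _~_

  open Inverse index public using () renaming (to to toFin; from to fromFin)

module _ (G : FiniteSimpleGraph) where
  open FiniteSimpleGraph G

  VertexSet : Set
  VertexSet = Subset order

  infix 4 _∈ⱽ_ _∈ⱽ?_

  _∈ⱽ_ : Vertex → VertexSet → Set
  v ∈ⱽ D = toFin v ∈ˢ D

  Dominating : VertexSet → Set
  Dominating D = ∀ v → v ∈ⱽ D ⊎ ∃ λ u → u ∈ⱽ D × v ~ u

  _∈ⱽ?_ : Decidable _∈ⱽ_
  v ∈ⱽ? D = toFin v ∈ˢ? D

  private
    fromFin-toFin : ∀ v → fromFin (toFin v) ≡ v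
    fromFin-toFin = Inverse.strictlyInverseʳ index

  allⱽ? : {P : Vertex → Set} → Decidable₁ P → Dec (∀ v → P v)
  allⱽ? {P} P? = map′ (λ f v → subst P (fromFin-toFin v) (f (toFin v))) (_∘ fromFin)
                      (all? (P? ∘ fromFin))

  anyⱽ? : {P : Vertex → Set} → Decidable₁ P → Dec (∃ P)
  anyⱽ? {P} P? = map′ (λ (i , p) → fromFin i , p)
                      (λ (v , p) → toFin v , subst P (sym (fromFin-toFin v)) p)
                      (any? (P? ∘ fromFin))

  dominating? : Decidable₁ Dominating
  dominating? D = allⱽ? λ v → (v ∈ⱽ? D) ⊎-dec anyⱽ? λ u → (u ∈ⱽ? D) ×-dec (v ~? u)

  dominatingSets : List VertexSet
  dominatingSets = filter dominating? (subsets order)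

  -- The default value `order` is harmless: it is the size of the full
  -- vertex set, which is dominating.
  γ : ℕ
  γ = min order (map ∣_∣ dominatingSets)

  minimumDominatingSets : List VertexSet
  minimumDominatingSets = filter (λ D → ∣ D ∣ ≟ γ) dominatingSets

  ζ : ℕ
  ζ = length minimumDominatingSets

  ∈-dominatingSets : ∀ D → D ∈ dominatingSets ⇔ Dominating D
  ∈-dominatingSets D = mk⇔ (proj₂ ∘ ∈-filter⁻ dominating? {xs = subsets order})
                           (∈-filter⁺ dominating? (∈-subsets D))

  γ-attained : ∃ λ D → Dominating D × ∣ D ∣ ≡ γ
  γ-attained with argmin-sel id order (map ∣_∣ dominatingSets)
  ... | inj₁ γ≡order = full , (λ _ → inj₁ ∈⊤) , trans (∣⊤∣≡n order) (sym γ≡order)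
  ... | inj₂ γ∈sizes with ∈-map⁻ ∣_∣ γ∈sizes
  ...   | D , D∈ , γ≡∣D∣ = D , proj₂ (∈-filter⁻ dominating? {xs = subsets order} D∈) , sym γ≡∣D∣

  γ-minimum : ∀ D → Dominating D → γ ≤ ∣ D ∣
  γ-minimum D dom = lookup (min≤xs order (map ∣_∣ dominatingSets))
    (∈-map⁺ ∣_∣ (∈-filter⁺ dominating? (∈-subsets D) dom))

  ∈-minimumDominatingSets : ∀ D → D ∈ minimumDominatingSets ⇔ (Dominating D × ∣ D ∣ ≡ γ)
  ∈-minimumDominatingSets D = mk⇔
    (λ D∈ → let D∈′ , eq = ∈-filter⁻ (λ D → ∣ D ∣ ≟ γ) {xs = dominatingSets} D∈
            in proj₂ (∈-filter⁻ dominating? {xs = subsets order} D∈′) , eq)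
    (λ (dom , eq) → ∈-filter⁺ (λ D → ∣ D ∣ ≟ γ) (∈-filter⁺ dominating? (∈-subsets D) dom) eq)

  minimumDominatingSets-unique : Unique minimumDominatingSets
  minimumDominatingSets-unique =
    filter⁺ (λ D → ∣ D ∣ ≟ γ) (filter⁺ dominating? (subsets-unique order))

-- A vertex is the path leading to it from the root: `left v` is the
-- vertex v of the left subtree, which has height h.

data Node : ℕ → Set where
  root  : ∀ {h} → Node h
  left  : ∀ {h} → Node h → Node (suc h)
  right : ∀ {h} → Node h → Node (suc h)

-- u ▷ v : v is a child of u.

infix 4 _▷_ _▷?_

data _▷_ : ∀ {h} → Node h → Node h → Set where
  root▷left  : ∀ {h} → root {suc h} ▷ left root
  root▷right : ∀ {h} → root {suc h} ▷ right root
  left       : ∀ {h} {u v : Node h} → u ▷ v → left u ▷ left v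
  right      : ∀ {h} {u v : Node h} → u ▷ v → right u ▷ right v

_▷?_ : ∀ {h} → Decidable (_▷_ {h})
_       ▷? root            = no λ ()
root    ▷? left root       = yes root▷left
root    ▷? left (left _)   = no λ ()
root    ▷? left (right _)  = no λ ()
left u  ▷? left v          = map′ left (λ { (left p) → p }) (u ▷? v)
right _ ▷? left _          = no λ ()
root    ▷? right root      = yes root▷right
root    ▷? right (left _)  = no λ ()
root    ▷? right (right _) = no λ ()
left _  ▷? right _         = no λ ()
right u ▷? right v         = map′ right (λ { (right p) → p }) (u ▷? v)

▷-irrefl : ∀ {h} {v : Node h} → ¬ v ▷ v
▷-irrefl (left p)  = ▷-irrefl p
▷-irrefl (right p) = ▷-irrefl p

size : ℕ → ℕ
size zero    = 1
size (suc h) = suc (size h + size h)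

nodeToFin : ∀ {h} → Node h → Fin (size h)
nodeToFin {zero}  root      = zero
nodeToFin {suc h} root      = zero
nodeToFin {suc h} (left v)  = suc (nodeToFin v ↑ˡ size h)
nodeToFin {suc h} (right v) = suc (size h ↑ʳ nodeToFin v)

finToNode : ∀ {h} → Fin (size h) → Node h
finToNode {zero}  _       = root
finToNode {suc h} zero    = root
finToNode {suc h} (suc i) =
  [ (λ j → left (finToNode j)) , (λ j → right (finToNode j)) ]′ (splitAt (size h) i)

finToNode-nodeToFin : ∀ {h} (v : Node h) → finToNode (nodeToFin v) ≡ v
finToNode-nodeToFin {zero}  root     = refl
finToNode-nodeToFin {suc h} root     = refl
finToNode-nodeToFin {suc h} (left v)
  rewrite splitAt-↑ˡ (size h) (nodeToFin v) (size h)  = cong left (finToNode-nodeToFin v)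
finToNode-nodeToFin {suc h} (right v)
  rewrite splitAt-↑ʳ (size h) (size h) (nodeToFin v) = cong right (finToNode-nodeToFin v)

nodeToFin-finToNode : ∀ {h} (i : Fin (size h)) → nodeToFin (finToNode {h} i) ≡ i
nodeToFin-finToNode {zero}  zero    = refl
nodeToFin-finToNode {suc h} zero    = refl
nodeToFin-finToNode {suc h} (suc i) = trans (step (splitAt (size h) i))
                                            (cong suc (join-splitAt (size h) (size h) i))
  where
  step : ∀ s → nodeToFin {suc h} ([ (λ j → left (finToNode j)) , (λ j → right (finToNode j)) ]′ s)
             ≡ suc (join (size h) (size h) s)
  step (inj₁ j) = cong (λ k → suc (k ↑ˡ size h)) (nodeToFin-finToNode {h} j)
  step (inj₂ j) = cong (λ k → suc (size h ↑ʳ k)) (nodeToFin-finToNode {h} j)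

T : ℕ → FiniteSimpleGraph
T h = record
  { Vertex   = Node h
  ; order    = size h
  ; index    = mk↔ₛ′ nodeToFin finToNode (nodeToFin-finToNode {h}) finToNode-nodeToFin
  ; _~_      = SymClosure _▷_
  ; ~-sym    = symmetric _▷_
  ; ~-irrefl = λ { refl (fwd p) → ▷-irrefl p ; refl (bwd p) → ▷-irrefl p }
  ; _~?_     = λ u v → map′ [ fwd , bwd ]′ (λ { (fwd p) → inj₁ p ; (bwd p) → inj₂ p })
                            ((u ▷? v) ⊎-dec (v ▷? u))
  }

-- The facts below identify T h as the complete binary tree of height h:
-- every vertex other than the root has exactly one parent, the vertices of
-- depth less than h have exactly two children, and those of depth h have
-- none. Since the root has depth 0 and a child is one deeper than its
-- parent, depth is distance from the root.

size≡ : ∀ h → size h ≡ 2 ^ (h + 1) ∸ 1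
size≡ h = cong (_∸ 1) (suc-size h)
  where
  suc-size : ∀ h → suc (size h) ≡ 2 ^ (h + 1)
  suc-size zero    = refl
  suc-size (suc h) = begin
    suc (suc (size h + size h))         ≡⟨ cong suc (+-suc (size h) (size h)) ⟨
    suc (size h) + suc (size h)         ≡⟨ cong₂ _+_ (suc-size h) (suc-size h) ⟩
    2 ^ (h + 1) + 2 ^ (h + 1)           ≡⟨ cong (2 ^ (h + 1) +_) (+-identityʳ (2 ^ (h + 1))) ⟨
    2 ^ (h + 1) + (2 ^ (h + 1) + 0)     ∎
    where open ≡-Reasoning

depth : ∀ {h} → Node h → ℕ
depth root      = 0
depth (left v)  = suc (depth v)
depth (right v) = suc (depth v)

depth≤height : ∀ {h} (v : Node h) → depth v ≤ h
depth≤height root      = z≤n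
depth≤height (left v)  = s≤s (depth≤height v)
depth≤height (right v) = s≤s (depth≤height v)

depth-child : ∀ {h} {u v : Node h} → u ▷ v → depth v ≡ suc (depth u)
depth-child root▷left  = refl
depth-child root▷right = refl
depth-child (left p)   = cong suc (depth-child p)
depth-child (right p)  = cong suc (depth-child p)

root-no-parent : ∀ {h} {u : Node h} → ¬ u ▷ root
root-no-parent ()

parent-exists : ∀ {h} (v : Node h) → v ≢ root → ∃ (_▷ v)
parent-exists root              v≢root = ⊥-elim (v≢root refl)
parent-exists (left root)       _      = root , root▷left
parent-exists (left (left v))   _      = let u , p = parent-exists (left v)  λ () in left u , left p
parent-exists (left (right v))  _      = let u , p = parent-exists (right v) λ () in left u , left p
parent-exists (right root)      _      = root , root▷right
parent-exists (right (left v))  _      = let u , p = parent-exists (left v)  λ () in right u , right p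
parent-exists (right (right v)) _      = let u , p = parent-exists (right v) λ () in right u , right p

parent-unique : ∀ {h} {u₁ u₂ v : Node h} → u₁ ▷ v → u₂ ▷ v → u₁ ≡ u₂
parent-unique root▷left  root▷left  = refl
parent-unique root▷right root▷right = refl
parent-unique (left p)   (left q)   = cong left (parent-unique p q)
parent-unique (right p)  (right q)  = cong right (parent-unique p q)

two-children : ∀ {h} (u : Node h) → depth u < h →
               ∃₂ λ v₁ v₂ → v₁ ≢ v₂ × (∀ w → u ▷ w ⇔ (w ≡ v₁ ⊎ w ≡ v₂))
two-children {suc h} root _ = left root , right root , (λ ()) , λ w → mk⇔
  (λ { root▷left → inj₁ refl ; root▷right → inj₂ refl })
  (λ { (inj₁ refl) → root▷left ; (inj₂ refl) → root▷right })
two-children (left u) (s≤s d) with two-children u d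
... | v₁ , v₂ , v₁≢v₂ , ch = left v₁ , left v₂ , (λ { refl → v₁≢v₂ refl }) , λ w → mk⇔
  (λ { (left p) → [ inj₁ ∘ cong left , inj₂ ∘ cong left ]′ (Equivalence.to (ch _) p) })
  (λ { (inj₁ refl) → left (Equivalence.from (ch _) (inj₁ refl))
     ; (inj₂ refl) → left (Equivalence.from (ch _) (inj₂ refl)) })
two-children (right u) (s≤s d) with two-children u d
... | v₁ , v₂ , v₁≢v₂ , ch = right v₁ , right v₂ , (λ { refl → v₁≢v₂ refl }) , λ w → mk⇔
  (λ { (right p) → [ inj₁ ∘ cong right , inj₂ ∘ cong right ]′ (Equivalence.to (ch _) p) })
  (λ { (inj₁ refl) → right (Equivalence.from (ch _) (inj₁ refl))
     ; (inj₂ refl) → right (Equivalence.from (ch _) (inj₂ refl)) })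

leaf-no-child : ∀ {h} {u v : Node h} → depth u ≡ h → ¬ u ▷ v
leaf-no-child ()   root▷left
leaf-no-child ()   root▷right
leaf-no-child d (left p)  = leaf-no-child (suc-injective d) p
leaf-no-child d (right p) = leaf-no-child (suc-injective d) p

{-# OPTIONS --safe #-}

-- Call a vertex set weakly dominating if it dominates every vertex except
-- possibly the root. A set D in T (suc h) consists of sets L and R in the two
-- subtrees of the root together with the status of the root: if the root is
-- chosen, then D is weakly dominating iff L and R are; otherwise D is weakly
-- dominating iff L and R are dominating. In every height there is exactly one
-- weakly dominating set of minimum size, and its behaviour at the root cycles
-- with period 3: it misses the root, then contains it, then dominates it
-- without containing it. In the first case a minimum dominating set is one
-- larger and arises by adding the root or one of its children, hence ζ = 3 (if
-- h > 0); in the other two cases the unique set is itself dominating, hence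
-- ζ = 1.

module Submission where

open import Defs
open import Data.Bool.Base using (Bool)
open import Data.Fin.Base using (zero; suc)
open import Data.Fin.Subset using (Subset; ∣_∣; inside; outside)
open import Data.List.Base using ([]; _∷_; length)
open import Data.List.Membership.Propositional using (_∈_)
open import Data.List.Membership.Propositional.Properties.WithK using (unique∧set⇒bag)
open import Data.List.Relation.Binary.BagAndSetEquality using (∼bag⇒↭)
open import Data.List.Relation.Binary.Permutation.Propositional.Properties using (↭-length)
open import Data.List.Relation.Unary.All using (All; []; _∷_; lookup)
open import Data.List.Relation.Unary.AllPairs using ([]; _∷_)
open import Data.List.Relation.Unary.Any using (here; there)
open import Data.List.Relation.Unary.Unique.Propositional using (Unique)
open import Data.Nat.Base using (ℕ; zero; suc; NonZero; _+_; _*_; _^_; _/_; _%_; _≤_; _<_; z≤n; s≤s)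
open import Data.Nat.Divisibility using (divides-refl)
open import Data.Nat.DivMod
  using (DivMod; _divMod_; result; [m+kn]%n≡m%n; m*n%n≡0; m*n/n≡m; m<n⇒m/n≡0; +-distrib-/-∣ʳ)
open import Data.Nat.Properties
  using (≤-reflexive; ≤-antisym; <⇒≤; <⇒≢; +-comm; +-suc; +-mono-≤; +-mono-<-≤; +-monoʳ-<)
open import Data.Nat.Tactic.RingSolver using (solve-∀)
open import Data.Product.Base using (Σ; ∃; _×_; _,_; proj₁; proj₂)
open import Data.Sum.Base using (_⊎_; inj₁; inj₂; map; map₁; [_,_]′)
open import Data.Vec.Base using ([]; _∷_; _++_; here; splitAt)
open import Data.Vec.Properties
  using (lookup-++ˡ; lookup-++ʳ; []=⇒lookup; lookup⇒[]=; ++-injectiveˡ; ∷-injectiveʳ)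
open import Function.Bundles using (Equivalence; mk⇔)
open import Level using (0ℓ)
open import Relation.Binary.Construct.Closure.Symmetric using (fwd; bwd)
open import Relation.Binary.PropositionalEquality
  using (_≡_; _≢_; refl; sym; trans; cong; cong₂; subst; module ≡-Reasoning)
open import Relation.Nullary using (¬_; contradiction)
open import Relation.Unary using (Pred)

-- Reading off γ and ζ from an explicit list.

-- The dichotomy in the last hypothesis gives both the lower bound `m` and the completeness of the
-- list. Two duplicate-free lists with the same members are permutations of each other, so their
-- lengths agree.
γζ-from-list : ∀ (G : FiniteSimpleGraph) m D Ds → Unique (D ∷ Ds) →
               All (λ E → Dominating G E × ∣ E ∣ ≡ m) (D ∷ Ds) →
               (∀ E → Dominating G E → E ∈ D ∷ Ds ⊎ m < ∣ E ∣) →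
               γ G ≡ m × ζ G ≡ suc (length Ds)
γζ-from-list G m D Ds unique all@((domD , ∣D∣≡m) ∷ _) covers =
  γ≡m , ↭-length (∼bag⇒↭ (unique∧set⇒bag (minimumDominatingSets-unique G) unique (mk⇔ to from)))
  where
  m≤ : ∀ E → Dominating G E → m ≤ ∣ E ∣
  m≤ E dom = [ (λ E∈ → ≤-reflexive (sym (proj₂ (lookup all E∈)))) , <⇒≤ ]′ (covers E dom)

  γ≡m : γ G ≡ m
  γ≡m with γ-attained G
  ... | E , dom , ∣E∣≡γ = ≤-antisym (subst (γ G ≤_) ∣D∣≡m (γ-minimum G D domD))
                                    (subst (m ≤_) ∣E∣≡γ (m≤ E dom))

  to : ∀ {E} → E ∈ minimumDominatingSets G → E ∈ D ∷ Ds
  to {E} E∈ with Equivalence.to (∈-minimumDominatingSets G E) E∈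
  ... | dom , ∣E∣≡γ with covers E dom
  ...   | inj₁ E∈′  = E∈′
  ...   | inj₂ m<∣E∣ = contradiction (sym (trans ∣E∣≡γ γ≡m)) (<⇒≢ m<∣E∣)

  from : ∀ {E} → E ∈ D ∷ Ds → E ∈ minimumDominatingSets G
  from {E} E∈ with lookup all E∈
  ... | dom , ∣E∣≡m = Equivalence.from (∈-minimumDominatingSets G E) (dom , trans ∣E∣≡m (sym γ≡m))

-- Splitting a vertex set at the root.

∣++∣ : ∀ {m n} (p : Subset m) (q : Subset n) → ∣ p ++ q ∣ ≡ ∣ p ∣ + ∣ q ∣
∣++∣ []            q = refl
∣++∣ (inside  ∷ p) q = cong suc (∣++∣ p q)
∣++∣ (outside ∷ p) q = ∣++∣ p q

join : ∀ {n} → Bool → Subset n → Subset n → Subset (suc (n + n))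
join b L R = b ∷ (L ++ R)

-- Replaces pattern matching on a vertex set, which cannot see through `_++_`.
join-elim : ∀ {n} (P : Pred (Subset (suc (n + n))) 0ℓ) → (∀ b L R → P (join b L R)) → ∀ D → P D
join-elim {n} P f (b ∷ D) with splitAt n D
... | L , R , refl = f b L R

module _ {n} (L R L′ R′ : Subset n) where

  ∣join∣-mono-< : ∀ b → ∣ L ∣ + ∣ R ∣ < ∣ L′ ∣ + ∣ R′ ∣ → ∣ join b L R ∣ < ∣ join b L′ R′ ∣
  ∣join∣-mono-< inside  lt rewrite ∣++∣ L R | ∣++∣ L′ R′ = s≤s lt
  ∣join∣-mono-< outside lt rewrite ∣++∣ L R | ∣++∣ L′ R′ = lt

  ∣join-outside∣<∣join-inside∣ : ∣ L ∣ + ∣ R ∣ ≤ ∣ L′ ∣ + ∣ R′ ∣ →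
                                 ∣ join outside L R ∣ < ∣ join inside L′ R′ ∣
  ∣join-outside∣<∣join-inside∣ le rewrite ∣++∣ L R | ∣++∣ L′ R′ = s≤s le

  -- Strict gaps on both sides add up to at least two: one pays for the chosen root, one remains.
  ∣join-inside∣<∣join-outside∣ : ∣ L ∣ < ∣ L′ ∣ → ∣ R ∣ < ∣ R′ ∣ →
                                 ∣ join inside L R ∣ < ∣ join outside L′ R′ ∣
  ∣join-inside∣<∣join-outside∣ lt lt′ rewrite ∣++∣ L R | ∣++∣ L′ R′ =
    subst (_≤ ∣ L′ ∣ + ∣ R′ ∣) (cong suc (+-suc ∣ L ∣ ∣ R ∣)) (+-mono-≤ lt lt′)

-- Domination in a tree versus domination in its two subtrees.

Dominated : ∀ h → VertexSet (T h) → Node h → Set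
Dominated h D v = _∈ⱽ_ (T h) v D ⊎ ∃ λ u → _∈ⱽ_ (T h) u D × FiniteSimpleGraph._~_ (T h) v u

Weak : ∀ h → VertexSet (T h) → Set
Weak h D = ∀ v → v ≢ root → Dominated h D v

Rooted : ∀ h → VertexSet (T h) → Set
Rooted h D = _∈ⱽ_ (T h) root D

Dominating⇒Weak : ∀ h {D} → Dominating (T h) D → Weak h D
Dominating⇒Weak h dom v _ = dom v

module _ (h : ℕ) {b : Bool} (L R : VertexSet (T h)) where

  left-∈⁺ : ∀ {v} → _∈ⱽ_ (T h) v L → _∈ⱽ_ (T (suc h)) (left v) (join b L R)
  left-∈⁺ {v} p = lookup⇒[]= _ _ (trans (lookup-++ˡ L R (nodeToFin v)) ([]=⇒lookup p))

  left-∈⁻ : ∀ {v} → _∈ⱽ_ (T (suc h)) (left v) (join b L R) → _∈ⱽ_ (T h) v L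
  left-∈⁻ {v} p = lookup⇒[]= _ _ (trans (sym (lookup-++ˡ L R (nodeToFin v))) ([]=⇒lookup p))

  right-∈⁺ : ∀ {v} → _∈ⱽ_ (T h) v R → _∈ⱽ_ (T (suc h)) (right v) (join b L R)
  right-∈⁺ {v} p = lookup⇒[]= _ _ (trans (lookup-++ʳ L R (nodeToFin v)) ([]=⇒lookup p))

  right-∈⁻ : ∀ {v} → _∈ⱽ_ (T (suc h)) (right v) (join b L R) → _∈ⱽ_ (T h) v R
  right-∈⁻ {v} p = lookup⇒[]= _ _ (trans (sym (lookup-++ʳ L R (nodeToFin v))) ([]=⇒lookup p))

  left-dominated⁺ : ∀ {v} → Dominated h L v → Dominated (suc h) (join b L R) (left v)
  left-dominated⁺ (inj₁ p)               = inj₁ (left-∈⁺ p)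
  left-dominated⁺ (inj₂ (u , p , fwd e)) = inj₂ (left u , left-∈⁺ p , fwd (left e))
  left-dominated⁺ (inj₂ (u , p , bwd e)) = inj₂ (left u , left-∈⁺ p , bwd (left e))

  right-dominated⁺ : ∀ {v} → Dominated h R v → Dominated (suc h) (join b L R) (right v)
  right-dominated⁺ (inj₁ p)               = inj₁ (right-∈⁺ p)
  right-dominated⁺ (inj₂ (u , p , fwd e)) = inj₂ (right u , right-∈⁺ p , fwd (right e))
  right-dominated⁺ (inj₂ (u , p , bwd e)) = inj₂ (right u , right-∈⁺ p , bwd (right e))

  -- The only edge leaving the left subtree joins its root to the root of the whole tree, so help
  -- from outside reaches no other vertex.
  left-dominated⁻ : ∀ {v} → Dominated (suc h) (join b L R) (left v) →
                    Dominated h L v ⊎ (b ≡ inside × v ≡ root)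
  left-dominated⁻ (inj₁ p)                           = inj₁ (inj₁ (left-∈⁻ p))
  left-dominated⁻ (inj₂ (left u , p , fwd (left e))) = inj₁ (inj₂ (u , left-∈⁻ p , fwd e))
  left-dominated⁻ (inj₂ (left u , p , bwd (left e))) = inj₁ (inj₂ (u , left-∈⁻ p , bwd e))
  left-dominated⁻ (inj₂ (root , here , bwd root▷left)) = inj₂ (refl , refl)

  right-dominated⁻ : ∀ {v} → Dominated (suc h) (join b L R) (right v) →
                     Dominated h R v ⊎ (b ≡ inside × v ≡ root)
  right-dominated⁻ (inj₁ p)                              = inj₁ (inj₁ (right-∈⁻ p))
  right-dominated⁻ (inj₂ (right u , p , fwd (right e)))  = inj₁ (inj₂ (u , right-∈⁻ p , fwd e))
  right-dominated⁻ (inj₂ (right u , p , bwd (right e)))  = inj₁ (inj₂ (u , right-∈⁻ p , bwd e))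
  right-dominated⁻ (inj₂ (root , here , bwd root▷right)) = inj₂ (refl , refl)

module _ (h : ℕ) (L R : VertexSet (T h)) where

  weak-inside⁻ : Weak (suc h) (join inside L R) → Weak h L × Weak h R
  weak-inside⁻ w =
    (λ v v≢root → [ (λ d → d) , (λ (_ , v≡root) → contradiction v≡root v≢root) ]′
                  (left-dominated⁻ h L R (w (left v) λ ()))) ,
    (λ v v≢root → [ (λ d → d) , (λ (_ , v≡root) → contradiction v≡root v≢root) ]′
                  (right-dominated⁻ h L R (w (right v) λ ())))

  weak-outside⁻ : Weak (suc h) (join outside L R) → Dominating (T h) L × Dominating (T h) R
  weak-outside⁻ w = (λ v → [ (λ d → d) , (λ ()) ]′ (left-dominated⁻ h L R (w (left v) λ ()))) ,
                    (λ v → [ (λ d → d) , (λ ()) ]′ (right-dominated⁻ h L R (w (right v) λ ())))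

  -- The chosen root dominates itself and its children, which are exactly the vertices that weak
  -- domination leaves open.
  dominating-inside⁺ : Weak h L → Weak h R → Dominating (T (suc h)) (join inside L R)
  dominating-inside⁺ wL wR root               = inj₁ here
  dominating-inside⁺ wL wR (left root)        = inj₂ (root , here , bwd root▷left)
  dominating-inside⁺ wL wR (left v@(left _))  = left-dominated⁺ h L R (wL v λ ())
  dominating-inside⁺ wL wR (left v@(right _)) = left-dominated⁺ h L R (wL v λ ())
  dominating-inside⁺ wL wR (right root)        = inj₂ (root , here , bwd root▷right)
  dominating-inside⁺ wL wR (right v@(left _))  = right-dominated⁺ h L R (wR v λ ())
  dominating-inside⁺ wL wR (right v@(right _)) = right-dominated⁺ h L R (wR v λ ())

  weak-outside⁺ : Dominating (T h) L → Dominating (T h) R → Weak (suc h) (join outside L R)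
  weak-outside⁺ dL dR root      root≢root = contradiction refl root≢root
  weak-outside⁺ dL dR (left v)  _         = left-dominated⁺ h L R (dL v)
  weak-outside⁺ dL dR (right v) _         = right-dominated⁺ h L R (dR v)

  dominating-outside⁻ : Dominating (T (suc h)) (join outside L R) → Rooted h L ⊎ Rooted h R
  dominating-outside⁻ dom with dom root
  ... | inj₂ (_ , p , fwd root▷left)  = inj₁ (left-∈⁻ h {outside} L R p)
  ... | inj₂ (_ , p , fwd root▷right) = inj₂ (right-∈⁻ h {outside} L R p)

  dominating-outside⁺ : Dominating (T h) L → Dominating (T h) R → Rooted h L ⊎ Rooted h R →
                        Dominating (T (suc h)) (join outside L R)
  dominating-outside⁺ dL dR (inj₁ p) root = inj₂ (left root , left-∈⁺ h L R p , fwd root▷left)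
  dominating-outside⁺ dL dR (inj₂ p) root = inj₂ (right root , right-∈⁺ h L R p , fwd root▷right)
  dominating-outside⁺ dL dR _ v@(left _)  = weak-outside⁺ dL dR v λ ()
  dominating-outside⁺ dL dR _ v@(right _) = weak-outside⁺ dL dR v λ ()

-- Unique sets of minimum size.

record UniqueMinimum {n} (P : Pred (Subset n) 0ℓ) (D : Subset n) : Set where
  field
    holds : P D
    beats : ∀ {E} → P E → E ≡ D ⊎ ∣ D ∣ < ∣ E ∣

  minimal : ∀ {E} → P E → ∣ D ∣ ≤ ∣ E ∣
  minimal p = [ (λ E≡D → ≤-reflexive (cong ∣_∣ (sym E≡D))) , <⇒≤ ]′ (beats p)

open UniqueMinimum

module _ {n} {P Q : Pred (Subset n) 0ℓ} {L R : Subset n}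
         (minL : UniqueMinimum P L) (minR : UniqueMinimum Q R) where

  +-minimal : ∀ {L′ R′} → P L′ → Q R′ → ∣ L ∣ + ∣ R ∣ ≤ ∣ L′ ∣ + ∣ R′ ∣
  +-minimal p q = +-mono-≤ (minimal minL p) (minimal minR q)

  -- Neither half can fall below its minimum, so a tie in the sum forces a tie, hence equality, in
  -- each half. `P` and `Q` may differ because the count of three requires just one of the subtrees
  -- to contain its root.
  join-beats : ∀ b L′ R′ → P L′ → Q R′ →
               join b L′ R′ ≡ join b L R ⊎ ∣ join b L R ∣ < ∣ join b L′ R′ ∣
  join-beats b L′ R′ p q with beats minL p | beats minR q
  ... | inj₁ refl | inj₁ refl = inj₁ refl
  ... | inj₁ refl | inj₂ R<R′ = inj₂ (∣join∣-mono-< L R L R′ b (+-monoʳ-< ∣ L ∣ R<R′))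
  ... | inj₂ L<L′ | _         = inj₂ (∣join∣-mono-< L R L′ R′ b (+-mono-<-≤ L<L′ (minimal minR q)))

-- Choosing the root only relaxes the demand on the subtrees from dominating to weakly dominating.
-- This saves nothing when the weak minimum already dominates, so the root would be a pure extra
-- cost.
join-outside-minimum : ∀ h {C} → UniqueMinimum (Weak h) C → Dominating (T h) C →
                       UniqueMinimum (Weak (suc h)) (join outside C C)
join-outside-minimum h {C} minimum dom = record
  { holds = weak-outside⁺ h C C dom dom
  ; beats = λ {E} → join-elim {size h} Beaten beaten E }
  where
  Beaten : Pred (VertexSet (T (suc h))) 0ℓ
  Beaten E = Weak (suc h) E → E ≡ join outside C C ⊎ ∣ join outside C C ∣ < ∣ E ∣

  beaten : ∀ b L R → Beaten (join b L R)
  beaten inside  L R w = let wL , wR = weak-inside⁻ h L R w in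
    inj₂ (∣join-outside∣<∣join-inside∣ C C L R (+-minimal minimum minimum wL wR))
  beaten outside L R w = let dL , dR = weak-outside⁻ h L R w in
    join-beats minimum minimum outside L R (Dominating⇒Weak h dL) (Dominating⇒Weak h dR)

-- The three phases and the passage from each to the next.

-- The residues 4, 1, 2 of 2 ^ (h + 2) modulo 7 turn the recursion for ∣ C ∣ into the floor formula.

record Phase₀ (h : ℕ) : Set where
  field
    {C}     : VertexSet (T h)
    minimum : UniqueMinimum (Weak h) C
    ¬dom    : ¬ Dominating (T h) C
    2^≡     : 2 ^ (h + 2) ≡ 4 + ∣ C ∣ * 7

  dominating-larger : ∀ {D} → Dominating (T h) D → ∣ C ∣ < ∣ D ∣
  dominating-larger dom with beats minimum (Dominating⇒Weak h dom)
  ... | inj₁ refl = contradiction dom ¬dom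
  ... | inj₂ lt   = lt

record Phase₁ (h : ℕ) : Set where
  field
    {C}     : VertexSet (T h)
    minimum : UniqueMinimum (Weak h) C
    dom     : Dominating (T h) C
    rooted  : Rooted h C
    2^≡     : 2 ^ (h + 2) ≡ 1 + ∣ C ∣ * 7

record Phase₂ (h : ℕ) : Set where
  field
    {C}           : VertexSet (T h)
    minimum       : UniqueMinimum (Weak h) C
    dom           : Dominating (T h) C
    ¬rooted       : ¬ Rooted h C
    -- One height later, an unchosen root is dominated exactly if one of the sets below it is rooted.
    {C⁺}          : VertexSet (T h)
    dom⁺          : Dominating (T h) C⁺
    minimumRooted : UniqueMinimum (λ D → Weak h D × Rooted h D) C⁺
    ∣C⁺∣≡         : ∣ C⁺ ∣ ≡ suc ∣ C ∣
    2^≡           : 2 ^ (h + 2) ≡ 2 + ∣ C ∣ * 7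

phase₀-zero : Phase₀ 0
phase₀-zero = record
  { C       = outside ∷ []
  ; minimum = record
    { holds = λ { root root≢root → contradiction refl root≢root }
    ; beats = λ { {inside ∷ []} _ → inj₂ (s≤s z≤n) ; {outside ∷ []} _ → inj₁ refl } }
  ; ¬dom    = λ dom → not-dominated (dom root)
  ; 2^≡     = refl }
  where
  not-dominated : ¬ Dominated 0 (outside ∷ []) root
  not-dominated (inj₁ ())
  not-dominated (inj₂ (root , () , _))

-- Leaving the root unchosen forces both subtrees to be dominating, at one extra vertex each;
-- choosing it costs one in total.
phase₁-suc : ∀ h → Phase₀ h → Phase₁ (suc h)
phase₁-suc h ph = record
  { C       = join inside C C
  ; minimum = record
    { holds = Dominating⇒Weak (suc h) dom
    ; beats = λ {E} → join-elim {size h} Beaten beaten E }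
  ; dom     = dom
  ; rooted  = here
  ; 2^≡     = begin
      2 * 2 ^ (h + 2)                ≡⟨ cong (2 *_) 2^≡ ⟩
      -- Doubling the residue 4 gives 1 + 7; the carried 7 accounts for the chosen root.
      2 * (4 + ∣ C ∣ * 7)            ≡⟨ arithmetic ∣ C ∣ ⟩
      1 + suc (∣ C ∣ + ∣ C ∣) * 7    ≡⟨ cong (λ n → 1 + suc n * 7) (∣++∣ C C) ⟨
      1 + ∣ join inside C C ∣ * 7    ∎ }
  where
  open Phase₀ ph
  open ≡-Reasoning

  dom : Dominating (T (suc h)) (join inside C C)
  dom = dominating-inside⁺ h C C (holds minimum) (holds minimum)

  Beaten : Pred (VertexSet (T (suc h))) 0ℓ
  Beaten E = Weak (suc h) E → E ≡ join inside C C ⊎ ∣ join inside C C ∣ < ∣ E ∣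

  beaten : ∀ b L R → Beaten (join b L R)
  beaten inside  L R w = let wL , wR = weak-inside⁻ h L R w in
    join-beats minimum minimum inside L R wL wR
  beaten outside L R w = let dL , dR = weak-outside⁻ h L R w in
    inj₂ (∣join-inside∣<∣join-outside∣ C C L R (dominating-larger dL) (dominating-larger dR))

  arithmetic : ∀ c → 2 * (4 + c * 7) ≡ 1 + suc (c + c) * 7
  arithmetic = solve-∀

-- Since `C` dominates and is rooted, two copies of it dominate everything with the root unchosen.
-- If the root is required, the subtrees need only be weakly dominating, and two copies of `C` are
-- again optimal.
phase₂-suc : ∀ h → Phase₁ h → Phase₂ (suc h)
phase₂-suc h ph = record
  { C             = join outside C C
  ; minimum       = join-outside-minimum h minimum dom
  ; dom           = dominating-outside⁺ h C C dom dom (inj₁ rooted)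
  ; ¬rooted       = λ ()
  ; C⁺            = join inside C C
  ; dom⁺          = dom⁺
  ; minimumRooted = record
    { holds = Dominating⇒Weak (suc h) dom⁺ , here
    ; beats = λ {E} → join-elim {size h} BeatenRooted beatenRooted E }
  -- The two sets differ only in the leading bit, so the sizes agree by computation.
  ; ∣C⁺∣≡         = refl
  ; 2^≡           = begin
      2 * 2 ^ (h + 2)                ≡⟨ cong (2 *_) 2^≡ ⟩
      2 * (1 + ∣ C ∣ * 7)            ≡⟨ arithmetic ∣ C ∣ ⟩
      2 + (∣ C ∣ + ∣ C ∣) * 7        ≡⟨ cong (λ n → 2 + n * 7) (∣++∣ C C) ⟨
      2 + ∣ join outside C C ∣ * 7   ∎ }
  where
  open Phase₁ ph
  open ≡-Reasoning

  dom⁺ : Dominating (T (suc h)) (join inside C C)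
  dom⁺ = dominating-inside⁺ h C C (holds minimum) (holds minimum)

  BeatenRooted : Pred (VertexSet (T (suc h))) 0ℓ
  BeatenRooted E =
    Weak (suc h) E × Rooted (suc h) E → E ≡ join inside C C ⊎ ∣ join inside C C ∣ < ∣ E ∣

  beatenRooted : ∀ b L R → BeatenRooted (join b L R)
  beatenRooted inside L R (w , _) =
    let wL , wR = weak-inside⁻ h L R w in join-beats minimum minimum inside L R wL wR
  beatenRooted outside L R (_ , ())

  arithmetic : ∀ c → 2 * (1 + c * 7) ≡ 2 + (c + c) * 7
  arithmetic = solve-∀

module _ (h : ℕ) (ph : Phase₂ h) where
  open Phase₂ ph

  phase₀-suc : Phase₀ (suc h)
  phase₀-suc = record
    { C       = join outside C C
    ; minimum = join-outside-minimum h minimum dom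
    ; ¬dom    = λ d → [ ¬rooted , ¬rooted ]′ (dominating-outside⁻ h C C d)
    ; 2^≡     = begin
        2 * 2 ^ (h + 2)                ≡⟨ cong (2 *_) 2^≡ ⟩
        2 * (2 + ∣ C ∣ * 7)            ≡⟨ arithmetic ∣ C ∣ ⟩
        4 + (∣ C ∣ + ∣ C ∣) * 7        ≡⟨ cong (λ n → 4 + n * 7) (∣++∣ C C) ⟨
        4 + ∣ join outside C C ∣ * 7   ∎ }
    where
    open ≡-Reasoning

    arithmetic : ∀ c → 2 * (2 + c * 7) ≡ 4 + (c + c) * 7
    arithmetic = solve-∀

  -- If the root is unchosen, one of its children is chosen, and the subtree below that child costs
  -- at least `∣ C⁺ ∣`, one more than `∣ C ∣`. A chosen root costs one as well, so the three options
  -- tie.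
  γζ-phase₀-suc : γ (T (suc h)) ≡ suc ∣ Phase₀.C phase₀-suc ∣ × ζ (T (suc h)) ≡ 3
  γζ-phase₀-suc = γζ-from-list (T (suc h)) m D₁ (D₂ ∷ D₃ ∷ []) unique all
    (join-elim {size h} Covered covered)
    where
    m = suc ∣ join outside C C ∣
    D₁ = join inside C C
    D₂ = join outside C⁺ C
    D₃ = join outside C C⁺

    ∣D₂∣≡m : ∣ D₂ ∣ ≡ m
    ∣D₂∣≡m rewrite ∣++∣ C⁺ C | ∣++∣ C C = cong (_+ ∣ C ∣) ∣C⁺∣≡

    ∣D₃∣≡m : ∣ D₃ ∣ ≡ m
    ∣D₃∣≡m rewrite ∣++∣ C C⁺ | ∣++∣ C C = trans (cong (∣ C ∣ +_) ∣C⁺∣≡) (+-suc ∣ C ∣ ∣ C ∣)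

    rooted⁺ : Rooted h C⁺
    rooted⁺ = proj₂ (holds minimumRooted)

    D₂≢D₃ : D₂ ≢ D₃
    D₂≢D₃ eq = ¬rooted (subst (Rooted h) (++-injectiveˡ C⁺ C (∷-injectiveʳ eq)) rooted⁺)

    unique : Unique (D₁ ∷ D₂ ∷ D₃ ∷ [])
    unique = ((λ ()) ∷ (λ ()) ∷ []) ∷ (D₂≢D₃ ∷ []) ∷ [] ∷ []

    all : All (λ E → Dominating (T (suc h)) E × ∣ E ∣ ≡ m) (D₁ ∷ D₂ ∷ D₃ ∷ [])
    all = (dominating-inside⁺ h C C (holds minimum) (holds minimum) , refl)
        ∷ (dominating-outside⁺ h C⁺ C dom⁺ dom (inj₁ rooted⁺) , ∣D₂∣≡m)
        ∷ (dominating-outside⁺ h C C⁺ dom dom⁺ (inj₂ rooted⁺) , ∣D₃∣≡m)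
        ∷ []

    Covered : Pred (VertexSet (T (suc h))) 0ℓ
    Covered E = Dominating (T (suc h)) E → E ∈ D₁ ∷ D₂ ∷ D₃ ∷ [] ⊎ m < ∣ E ∣

    covered : ∀ b L R → Covered (join b L R)
    covered inside L R d =
      let wL , wR = weak-inside⁻ h L R (Dominating⇒Weak (suc h) d)
      in map₁ here (join-beats minimum minimum inside L R wL wR)
    covered outside L R d with weak-outside⁻ h L R (Dominating⇒Weak (suc h) d) | dominating-outside⁻ h L R d
    ... | dL , dR | inj₁ rL =
      map (λ eq → there (here eq)) (subst (_< ∣ join outside L R ∣) ∣D₂∣≡m)
        (join-beats minimumRooted minimum outside L R (Dominating⇒Weak h dL , rL) (Dominating⇒Weak h dR))
    ... | dL , dR | inj₂ rR =
      map (λ eq → there (there (here eq))) (subst (_< ∣ join outside L R ∣) ∣D₃∣≡m)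
        (join-beats minimum minimumRooted outside L R (Dominating⇒Weak h dL) (Dominating⇒Weak h dR , rR))

-- The floor formula and the cases modulo 3.

quotient-unique : ∀ d .{{_ : NonZero d}} {n r} q → r < d → n ≡ r + q * d → q ≡ n / d
quotient-unique d {r = r} q r<d refl = sym (begin
  (r + q * d) / d     ≡⟨ +-distrib-/-∣ʳ r (divides-refl q) ⟩
  r / d + q * d / d   ≡⟨ cong₂ _+_ (m<n⇒m/n≡0 r<d) (m*n/n≡m q d) ⟩
  q                   ∎)
  where open ≡-Reasoning

γζ-three : ∀ h → Phase₂ h → γ (T (suc h)) ≡ (2 ^ (suc h + 2) + 3) / 7 × ζ (T (suc h)) ≡ 3
-- Adding 3 to the residue 4 completes one more multiple of 7, matching the one vertex added to the
-- weak minimum; the remainder is 0.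
γζ-three h ph = trans γ≡ (quotient-unique 7 (suc ∣ C ∣) (s≤s z≤n) (begin
    2 ^ (suc h + 2) + 3    ≡⟨ cong (_+ 3) 2^≡ ⟩
    4 + ∣ C ∣ * 7 + 3      ≡⟨ arithmetic ∣ C ∣ ⟩
    suc ∣ C ∣ * 7          ∎)) , ζ≡
  where
  open Phase₀ (phase₀-suc h ph)
  open ≡-Reasoning
  open Σ (γζ-phase₀-suc h ph) renaming (proj₁ to γ≡; proj₂ to ζ≡)

  arithmetic : ∀ c → 4 + c * 7 + 3 ≡ suc c * 7
  arithmetic = solve-∀

-- Dominating sets are weakly dominating, so a weak minimum that dominates beats them all. The bound
-- on `r` keeps the added 3 from changing the quotient.
γζ-unique : ∀ h {C} → UniqueMinimum (Weak h) C → Dominating (T h) C →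
            ∀ r → 3 + r < 7 → 2 ^ (h + 2) ≡ r + ∣ C ∣ * 7 →
            γ (T h) ≡ (2 ^ (h + 2) + 3) / 7 × ζ (T h) ≡ 1
γζ-unique h {C} minimum dom r r<7 2^≡ = trans γ≡ (quotient-unique 7 ∣ C ∣ r<7 (begin
    2 ^ (h + 2) + 3        ≡⟨ +-comm (2 ^ (h + 2)) 3 ⟩
    3 + 2 ^ (h + 2)        ≡⟨ cong (3 +_) 2^≡ ⟩
    3 + r + ∣ C ∣ * 7      ∎)) , ζ≡
  where
  open ≡-Reasoning
  open Σ (γζ-from-list (T h) ∣ C ∣ C [] ([] ∷ []) ((dom , refl) ∷ [])
           λ E d → map₁ here (beats minimum (Dominating⇒Weak h d)))
    renaming (proj₁ to γ≡; proj₂ to ζ≡)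

-- Heights have the form remainder plus `k * 3` to match the equation supplied by `DivMod`.
phase₀ : ∀ k → Phase₀ (k * 3)
phase₁ : ∀ k → Phase₁ (1 + k * 3)
phase₂ : ∀ k → Phase₂ (2 + k * 3)
phase₀ zero    = phase₀-zero
phase₀ (suc k) = phase₀-suc (2 + k * 3) (phase₂ k)
phase₁ k       = phase₁-suc (k * 3) (phase₀ k)
phase₂ k       = phase₂-suc (1 + k * 3) (phase₁ k)

Claim : ℕ → Set
Claim h = γ (T h) ≡ (2 ^ (h + 2) + 3) / 7 ×
          (h % 3 ≡ 0 × 3 ≤ h → ζ (T h) ≡ 3) ×
          (¬ (h % 3 ≡ 0 × 3 ≤ h) → ζ (T h) ≡ 1)

claim : ∀ {h} → 1 ≤ h → DivMod h 3 → Claim h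
-- Height 0 is excluded by the bound; there the root has no children that could replace it.
claim 1≤0 (result zero zero refl) = contradiction 1≤0 λ ()
claim _ (result (suc k) zero refl) = γ≡ , (λ _ → ζ≡) ,
  -- Partially applied: the remaining argument is the assumed negation of the condition.
  contradiction (m*n%n≡0 (suc k) 3 , s≤s (s≤s (s≤s z≤n)))
  where open Σ (γζ-three (2 + k * 3) (phase₂ k)) renaming (proj₁ to γ≡; proj₂ to ζ≡)
claim _ (result k (suc zero) refl) = γ≡ ,
  (λ (h%3≡0 , _) → contradiction (trans (sym ([m+kn]%n≡m%n 1 k 3)) h%3≡0) λ ()) , λ _ → ζ≡
  where
  open Phase₁ (phase₁ k)
  open Σ (γζ-unique (1 + k * 3) minimum dom 1 (s≤s (s≤s (s≤s (s≤s (s≤s z≤n))))) 2^≡)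
    renaming (proj₁ to γ≡; proj₂ to ζ≡)
claim _ (result k (suc (suc zero)) refl) = γ≡ ,
  (λ (h%3≡0 , _) → contradiction (trans (sym ([m+kn]%n≡m%n 2 k 3)) h%3≡0) λ ()) , λ _ → ζ≡
  where
  open Phase₂ (phase₂ k)
  open Σ (γζ-unique (2 + k * 3) minimum dom 2 (s≤s (s≤s (s≤s (s≤s (s≤s (s≤s z≤n)))))) 2^≡)
    renaming (proj₁ to γ≡; proj₂ to ζ≡)

theorem10 : (h : ℕ) → 1 ≤ h →
    γ (T h) ≡ (2 ^ (h + 2) + 3) / 7 ×
    (h % 3 ≡ 0 × 3 ≤ h → ζ (T h) ≡ 3) ×
    (¬ (h % 3 ≡ 0 × 3 ≤ h) → ζ (T h) ≡ 1)
theorem10 h 1≤h = claim 1≤h (h divMod 3)
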